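{- Let $m\in\mathbb{N}$, $a>-1$, and $Q(x)=(x^{4}+2ax^{2}+1)^{ -(m+1)}$. For real $y$ define $$Q_{1}(y)=\Big[Q\big(y+\sqrt{y^{2}+1}\big)+Q\big(y-\sqrt{y^{2}+1}\big)\Big]+\frac{y}{\sqrt{y^{2}+1}}\Big[Q\big(y+\sqrt{y^{2}+1}\big)-Q\big(y-\sqrt{y^{2}+1}\big)\Big].$$ Then $$Q_{1}(y)=\frac{T_{m}(2y)}{2^{m}(1+a+2y^{2})^{m+1}},\qquad\text{where } T_{m}(y)=\sum_{k=0}^{m}\binom{m+k}{m-k}y^{2k}.$$ -}

module Defs where

module ℚ-lemmas where

  open import Data.Nat.Base as ℕ using (ℕ; zero; suc)
  import Data.Nat.Properties as ℕₚ
  open import Data.Integer.Base as ℤ using (+_)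
  import Data.Integer.Properties as ℤₚ
  open import Data.Rational.Base
  open import Data.Rational.Properties
  import Data.Rational.Unnormalised.Base as ℚᵘ
  import Data.Rational.Unnormalised.Properties as ℚᵘₚ
  open import Data.Rational.Solver using (module +-*-Solver)
  open +-*-Solver
  open import Data.Product.Base using (_×_; _,_; proj₁; proj₂; ∃-syntax)
  open import Data.Sum.Base using (_⊎_; inj₁; inj₂)
  open import Relation.Nullary.Decidable.Core using (yes; no)
  open import Relation.Nullary.Negation.Core using (¬_; contradiction)
  open import Relation.Binary.PropositionalEquality.Core
    using (_≡_; refl; sym; trans; cong; cong₂; subst; subst₂; _≢_)

  0<1 : 0ℚ < 1ℚ
  0<1 = positive⁻¹ 1ℚ
  0<½ : 0ℚ < ½
  0<½ = positive⁻¹ ½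

  +-pos : ∀ {p q} → 0ℚ < p → 0ℚ < q → 0ℚ < p + q
  +-pos 0<p 0<q = +-mono-< 0<p 0<q

  +-nonneg : ∀ {p q} → 0ℚ ≤ p → 0ℚ ≤ q → 0ℚ ≤ p + q
  +-nonneg = +-mono-≤

  *-pos : ∀ {p q} → 0ℚ < p → 0ℚ < q → 0ℚ < p * q
  *-pos {p} {q} a b = positive⁻¹ (p * q) {{pos*pos⇒pos p {{positive a}} q {{positive b}}}}

  *-nonneg : ∀ {p q} → 0ℚ ≤ p → 0ℚ ≤ q → 0ℚ ≤ p * q
  *-nonneg {p} {q} a b =
    nonNegative⁻¹ (p * q) {{nonNeg*nonNeg⇒nonNeg p {{nonNegative a}} q {{nonNegative b}}}}

  0<⇒< : ∀ {p q} → 0ℚ < q - p → p < q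
  0<⇒< {p} {q} h = subst₂ _<_ (+-identityˡ p) (solve 2 (λ p q → q :- p :+ p := q) refl p q) (+-monoˡ-< p h)

  <⇒0< : ∀ {p q} → p < q → 0ℚ < q - p
  <⇒0< {p} {q} h = subst (_< q - p) (+-inverseʳ p) (+-monoˡ-< (- p) h)

  0≤⇒≤ : ∀ {p q} → 0ℚ ≤ q - p → p ≤ q
  0≤⇒≤ {p} {q} h = subst₂ _≤_ (+-identityˡ p) (solve 2 (λ p q → q :- p :+ p := q) refl p q) (+-monoˡ-≤ p h)

  ≤⇒0≤ : ∀ {p q} → p ≤ q → 0ℚ ≤ q - p
  ≤⇒0≤ {p} {q} h = subst (_≤ q - p) (+-inverseʳ p) (+-monoˡ-≤ (- p) h)

  *-mono-nonneg : ∀ {p q r s} → 0ℚ ≤ p → 0ℚ ≤ r → p ≤ q → r ≤ s → p * r ≤ q * s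
  *-mono-nonneg {p} {q} {r} {s} 0≤p 0≤r p≤q r≤s = ≤-trans
    (*-monoʳ-≤-nonNeg r {{nonNegative 0≤r}} p≤q)
    (*-monoˡ-≤-nonNeg q {{nonNegative (≤-trans 0≤p p≤q)}} r≤s)

  sq-nonneg : ∀ p → 0ℚ ≤ p * p
  sq-nonneg p with ≤-total 0ℚ p
  ... | inj₁ h = *-nonneg h h
  ... | inj₂ h = subst (0ℚ ≤_) (solve 1 (λ p → (:- p) :* (:- p) := p :* p) refl p)
                   (*-nonneg (neg-antimono-≤ h) (neg-antimono-≤ h))

  p≤∣p∣ : ∀ p → p ≤ ∣ p ∣
  p≤∣p∣ p with ≤-total 0ℚ p
  ... | inj₁ h = ≤-reflexive (sym (0≤p⇒∣p∣≡p h))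
  ... | inj₂ h = ≤-trans h (0≤∣p∣ p)

  ∣p∣< : ∀ {p e} → p < e → - p < e → ∣ p ∣ < e
  ∣p∣< {p} {e} a b with ∣p∣≡p∨∣p∣≡-p p
  ... | inj₁ h = subst (_< e) (sym h) a
  ... | inj₂ h = subst (_< e) (sym h) b

  ∣p-q∣≡∣q-p∣ : ∀ p q → ∣ p - q ∣ ≡ ∣ q - p ∣
  ∣p-q∣≡∣q-p∣ p q = trans (cong ∣_∣ (solve 2 (λ p q → p :- q := :- (q :- p)) refl p q)) (∣-p∣≡∣p∣ (q - p))

  ∣∣-triangle : ∀ p q r → ∣ p - r ∣ ≤ ∣ p - q ∣ + ∣ q - r ∣
  ∣∣-triangle p q r = ≤-trans
    (≤-reflexive (cong ∣_∣ (solve 3 (λ p q r → p :- r := (p :- q) :+ (q :- r)) refl p q r)))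
    (∣p+q∣≤∣p∣+∣q∣ (p - q) (q - r))

  ∣∣-+ : ∀ p q r s → ∣ (p + q) - (r + s) ∣ ≤ ∣ p - r ∣ + ∣ q - s ∣
  ∣∣-+ p q r s = ≤-trans
    (≤-reflexive (cong ∣_∣ (solve 4 (λ p q r s → (p :+ q) :- (r :+ s) := (p :- r) :+ (q :- s)) refl p q r s)))
    (∣p+q∣≤∣p∣+∣q∣ (p - r) (q - s))

  ∣∣-neg : ∀ p q → ∣ (- p) - (- q) ∣ ≡ ∣ p - q ∣
  ∣∣-neg p q = trans (cong ∣_∣ (solve 2 (λ p q → (:- p) :- (:- q) := :- (p :- q)) refl p q)) (∣-p∣≡∣p∣ (p - q))

  ∣∣-* : ∀ p q r s → ∣ p * q - r * s ∣ ≤ ∣ p ∣ * ∣ q - s ∣ + ∣ p - r ∣ * ∣ s ∣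
  ∣∣-* p q r s = ≤-trans
    (≤-reflexive (cong ∣_∣ (solve 4 (λ p q r s → p :* q :- r :* s := p :* (q :- s) :+ (p :- r) :* s) refl p q r s)))
    (≤-trans (∣p+q∣≤∣p∣+∣q∣ (p * (q - s)) ((p - r) * s))
      (≤-reflexive (cong₂ _+_ (∣p*q∣≡∣p∣*∣q∣ p (q - s)) (∣p*q∣≡∣p∣*∣q∣ (p - r) s))))

  half-pos : ∀ {ε} → 0ℚ < ε → 0ℚ < ½ * ε
  half-pos = *-pos 0<½

  halves : ∀ ε → ½ * ε + ½ * ε ≡ ε
  halves = solve 1 (λ ε → con ½ :* ε :+ con ½ :* ε := ε) refl

  quotient : ∀ {ε K} → 0ℚ < ε → 0ℚ < K → ∃[ δ ] 0ℚ < δ × K * δ ≡ ε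
  quotient {ε} {K} 0<ε 0<K = i * ε , *-pos (positive⁻¹ i {{1/pos⇒pos K {{pK}}}}) 0<ε ,
    trans (sym (*-assoc K i ε)) (trans (cong (_* ε) (*-inverseʳ K {{nz}})) (*-identityˡ ε))
    where
    pK = positive 0<K
    nz = pos⇒nonZero K {{pK}}
    i = (1/ K) {{nz}}

  ∣∣-*-small : ∀ {p q r s A D δ} → 0ℚ < A → 0ℚ < D →
    ∣ p ∣ < A → ∣ s ∣ < D → ∣ q - s ∣ < δ → ∣ p - r ∣ < δ → ∣ p * q - r * s ∣ ≤ (A + D) * δ
  ∣∣-*-small {p} {q} {r} {s} {A} {D} {δ} 0<A 0<D p<A s<D a b = ≤-trans (∣∣-* p q r s)
    (subst (∣ p ∣ * ∣ q - s ∣ + ∣ p - r ∣ * ∣ s ∣ ≤_)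
      (solve 3 (λ A D δ → A :* δ :+ δ :* D := (A :+ D) :* δ) refl A D δ)
      (+-mono-≤ (*-mono-nonneg (0≤∣p∣ p) (0≤∣p∣ (q - s)) (<⇒≤ p<A) (<⇒≤ a))
                (*-mono-nonneg (0≤∣p∣ (p - r)) (0≤∣p∣ s) (<⇒≤ b) (<⇒≤ s<D))))

  -- Total on ℚ with recip 0 = 0; a sequence bounded away from 0 meets that value
  -- at most finitely often.
  recip : ℚ → ℚ
  recip p with p ≟ 0ℚ
  ... | yes _ = 0ℚ
  ... | no p≢0 = (1/ p) {{≢-nonZero p≢0}}

  recip-inverseʳ : ∀ p → p ≢ 0ℚ → p * recip p ≡ 1ℚ
  recip-inverseʳ p p≢0 with p ≟ 0ℚ
  ... | yes p≡0 = contradiction p≡0 p≢0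
  ... | no h = *-inverseʳ p {{≢-nonZero h}}

  ≤∣p∣⇒≢0 : ∀ {p ε} → 0ℚ < ε → ε ≤ ∣ p ∣ → p ≢ 0ℚ
  ≤∣p∣⇒≢0 0<ε h refl = <-irrefl refl (<-≤-trans 0<ε h)

  recip-close : ∀ {p q ε δ} → 0ℚ < ε → 0ℚ < δ → ε ≤ ∣ p ∣ → ε ≤ ∣ q ∣ →
    ∣ p - q ∣ < δ * (ε * ε) → ∣ recip p - recip q ∣ < δ
  recip-close {p} {q} {ε} {δ} 0<ε 0<δ hp hq h = ≰⇒> λ bad → <-irrefl refl (<-≤-trans h
    (≤-trans (*-mono-nonneg (<⇒≤ 0<δ) (<⇒≤ (*-pos 0<ε 0<ε)) bad
               (*-mono-nonneg (<⇒≤ 0<ε) (<⇒≤ 0<ε) hp hq))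
      (≤-reflexive eq)))
    where
    i = recip p
    j = recip q
    pi = recip-inverseʳ p (≤∣p∣⇒≢0 0<ε hp)
    qj = recip-inverseʳ q (≤∣p∣⇒≢0 0<ε hq)
    base : (i - j) * (p * q) ≡ q - p
    base = trans (solve 4 (λ p q i j → (i :- j) :* (p :* q) := q :* (p :* i) :- p :* (q :* j)) refl p q i j)
      (trans (cong₂ (λ u v → q * u - p * v) pi qj)
        (solve 2 (λ p q → q :* con 1ℚ :- p :* con 1ℚ := q :- p) refl p q))
    eq : ∣ i - j ∣ * (∣ p ∣ * ∣ q ∣) ≡ ∣ p - q ∣
    eq = trans (cong (∣ i - j ∣ *_) (sym (∣p*q∣≡∣p∣*∣q∣ p q)))
      (trans (sym (∣p*q∣≡∣p∣*∣q∣ (i - j) (p * q)))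
        (trans (cong ∣_∣ base) (∣p-q∣≡∣q-p∣ q p)))

  ι : ℕ → ℚ
  ι zero = 0ℚ
  ι (suc n) = 1ℚ + ι n

  ι-ᵘ : ∀ n → toℚᵘ (ι n) ℚᵘ.≃ ℚᵘ.mkℚᵘ (+ n) 0
  ι-ᵘ zero = ℚᵘₚ.≃-refl
  ι-ᵘ (suc n) = ℚᵘₚ.≃-trans (toℚᵘ-homo-+ 1ℚ (ι n))
    (ℚᵘₚ.≃-trans (ℚᵘₚ.+-congʳ ℚᵘ.1ℚᵘ (ι-ᵘ n)) (ℚᵘ.*≡* (cong (λ k → (+ 1 ℤ.+ k) ℤ.* + 1) (ℤₚ.*-identityʳ (+ n)))))

  archimedean : ∀ p → ∃[ n ] p ≤ ι n
  archimedean p@record{} = ℤ.∣ ↥ p ∣ , toℚᵘ-cancel-≤ (ℚᵘₚ.≤-respʳ-≃ (ℚᵘₚ.≃-sym (ι-ᵘ ℤ.∣ ↥ p ∣)) (ℚᵘ.*≤*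
     (ℤₚ.≤-trans (ℤₚ.≤-reflexive (ℤₚ.*-identityʳ (↥ p)))
       (ℤₚ.≤-trans (lem (↥ p)) (subst (ℤ._≤ + ℤ.∣ ↥ p ∣ ℤ.* ↧ p) (ℤₚ.*-identityʳ _) (ℤₚ.*-monoˡ-≤-nonNeg (+ ℤ.∣ ↥ p ∣) (ℤ.+≤+ (ℕ.s≤s ℕ.z≤n))))))))
    where
    lem : ∀ i → i ℤ.≤ + ℤ.∣ i ∣
    lem (+ n) = ℤₚ.≤-refl
    lem (ℤ.-[1+ n ]) = ℤ.-≤+

  ½^ : ℕ → ℚ
  ½^ zero = 1ℚ
  ½^ (suc n) = ½ * ½^ n

  ½^-pos : ∀ n → 0ℚ < ½^ n
  ½^-pos zero = 0<1
  ½^-pos (suc n) = half-pos (½^-pos n)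

  ½^-step : ∀ n → ½^ (suc n) ≤ ½^ n
  ½^-step n = subst (½ * ½^ n ≤_) (halves (½^ n))
    (subst (_≤ ½ * ½^ n + ½ * ½^ n) (+-identityʳ _) (+-monoʳ-≤ (½ * ½^ n) (<⇒≤ (half-pos (½^-pos n)))))

  ½^-anti′ : ∀ {m n} → m ℕ.≤′ n → ½^ n ≤ ½^ m
  ½^-anti′ (ℕ.≤′-reflexive refl) = ≤-refl
  ½^-anti′ (ℕ.≤′-step {n} h) = ≤-trans (½^-step n) (½^-anti′ h)

  ½^-anti : ∀ {m n} → m ℕ.≤ n → ½^ n ≤ ½^ m
  ½^-anti h = ½^-anti′ (ℕₚ.≤⇒≤′ h)

  ½^-ι : ∀ n → ½^ n * ι n ≤ 1ℚ
  ½^-ι zero = <⇒≤ 0<1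
  ½^-ι (suc n) = subst₂ _≤_
    (solve 2 (λ h i → con ½ :* h :+ con ½ :* (h :* i) := con ½ :* h :* (con 1ℚ :+ i)) refl (½^ n) (ι n))
    (halves 1ℚ)
    (+-mono-≤ (*-monoˡ-≤-nonNeg ½ (½^-anti {0} {n} ℕ.z≤n)) (*-monoˡ-≤-nonNeg ½ (½^-ι n)))

  ½^-small : ∀ {K ε} → 0ℚ < K → 0ℚ < ε → ∃[ N ] (∀ n → N ℕ.≤ n → K * ½^ n < ε)
  ½^-small {K} {ε} 0<K 0<ε with quotient 0<K (half-pos 0<ε)
  ... | t , 0<t , eq with archimedean t
  ... | N , t≤N = N , λ n N≤n → ≤-<-trans
    (≤-trans (*-monoˡ-≤-nonNeg K {{nonNegative (<⇒≤ 0<K)}} (½^-anti N≤n))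
    (≤-trans (≤-reflexive (trans (cong (_* ½^ N) (sym eq)) (*-assoc (½ * ε) t (½^ N))))
     (≤-trans (*-monoˡ-≤-nonNeg (½ * ε) {{nonNegative (<⇒≤ (half-pos 0<ε))}}
       (≤-trans (*-monoʳ-≤-nonNeg (½^ N) {{nonNegative (<⇒≤ (½^-pos N))}} t≤N)
         (≤-trans (≤-reflexive (*-comm (ι N) (½^ N))) (½^-ι N))))
        (≤-reflexive (*-identityʳ (½ * ε))))))
    (subst (½ * ε <_) (halves ε) (subst (_< ½ * ε + ½ * ε) (+-identityʳ _) (+-monoʳ-< (½ * ε) (half-pos 0<ε))))

  -- After n halvings of [0 , ∣ q ∣ + 1], √q lies in [bisect q n , bisect q n + width q n].
  -- For q < 0 every test fails and bisect q n = 0.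
  width : ℚ → ℕ → ℚ
  width q n = (∣ q ∣ + 1ℚ) * ½^ n

  bisect : ℚ → ℕ → ℚ
  bisect q zero = 0ℚ
  bisect q (suc n) with (bisect q n + width q (suc n)) * (bisect q n + width q (suc n)) ≤? q
  ... | yes _ = bisect q n + width q (suc n)
  ... | no  _ = bisect q n

  ∣q∣+1-pos : ∀ q → 0ℚ < ∣ q ∣ + 1ℚ
  ∣q∣+1-pos q = subst (_< ∣ q ∣ + 1ℚ) (+-identityˡ 0ℚ) (+-mono-≤-< (0≤∣p∣ q) 0<1)

  width-pos : ∀ q n → 0ℚ < width q n
  width-pos q n = *-pos (∣q∣+1-pos q) (½^-pos n)

  bisect-nonneg : ∀ q n → 0ℚ ≤ bisect q n
  bisect-nonneg q zero = ≤-refl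
  bisect-nonneg q (suc n) with (bisect q n + width q (suc n)) * (bisect q n + width q (suc n)) ≤? q
  ... | yes _ = +-nonneg (bisect-nonneg q n) (<⇒≤ (width-pos q (suc n)))
  ... | no  _ = bisect-nonneg q n

  bisect-below : ∀ q n → bisect q n ≡ 0ℚ ⊎ bisect q n * bisect q n ≤ q
  bisect-below q zero = inj₁ refl
  bisect-below q (suc n) with (bisect q n + width q (suc n)) * (bisect q n + width q (suc n)) ≤? q
  ... | yes h = inj₂ h
  ... | no  _ = bisect-below q n

  bisect-above : ∀ q n → q < (bisect q n + width q n) * (bisect q n + width q n)
  bisect-above q zero = ≤-<-trans (p≤∣p∣ q) (0<⇒< (subst (0ℚ <_)
    (solve 1 (λ t → t :* t :+ (t :+ con 1ℚ) :=
        (con 0ℚ :+ (t :+ con 1ℚ) :* con 1ℚ) :* (con 0ℚ :+ (t :+ con 1ℚ) :* con 1ℚ) :- t) refl ∣ q ∣)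
    (subst (_< ∣ q ∣ * ∣ q ∣ + (∣ q ∣ + 1ℚ)) (+-identityˡ 0ℚ) (+-mono-≤-< (sq-nonneg ∣ q ∣) (∣q∣+1-pos q)))))
  bisect-above q (suc n) with (bisect q n + width q (suc n)) * (bisect q n + width q (suc n)) ≤? q
  ... | yes _ = subst (λ z → q < z * z) (solve 3 (λ b t h → b :+ t :* h := b :+ t :* (con ½ :* h) :+ t :* (con ½ :* h)) refl (bisect q n) (∣ q ∣ + 1ℚ) (½^ n)) (bisect-above q n)
  ... | no  h = ≰⇒> h

  sq-mono-≤ : ∀ {p q} → 0ℚ ≤ p → p ≤ q → p * p ≤ q * q
  sq-mono-≤ 0≤p p≤q = *-mono-nonneg 0≤p 0≤p p≤q p≤q

  sq-cancel-< : ∀ {p q} → 0ℚ ≤ q → p * p < q * q → p < q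
  sq-cancel-< 0≤q h = ≰⇒> λ q≤p → <-irrefl refl (<-≤-trans h (sq-mono-≤ 0≤q q≤p))

  bisect-near : ∀ {η} p m q n → 0ℚ < η → ∣ p - q ∣ < η * η → bisect p m < bisect q n + width q n + η
  bisect-near {η} p m q n 0<η h = ≰⇒> bad
    where
    r = bisect p m
    s = bisect q n + width q n
    0<s : 0ℚ < s
    0<s = subst (_< s) (+-identityˡ 0ℚ) (+-mono-≤-< (bisect-nonneg q n) (width-pos q n))
    bad : ¬ (s + η ≤ r)
    bad b with bisect-below p m
    ... | inj₁ z = <-irrefl refl (<-≤-trans (+-pos 0<s 0<η) (subst (s + η ≤_) z b))
    ... | inj₂ r²≤p = <-irrefl refl (<-≤-trans (≤-<-trans (p≤∣p∣ (p - q)) h) (0≤⇒≤ (subst (0ℚ ≤_)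
            (solve 5 (λ p q r s η → ((p :- r :* r) :+ (r :* r :- (s :+ η) :* (s :+ η))) :+ ((s :* s :- q) :+ (s :* η :+ s :* η))
                       := p :- q :- η :* η) refl p q r s η)
            (+-nonneg (+-nonneg (≤⇒0≤ r²≤p) (≤⇒0≤ (sq-mono-≤ (<⇒≤ (+-pos 0<s 0<η)) b)))
              (+-nonneg (≤⇒0≤ (<⇒≤ (bisect-above q n))) (+-nonneg (<⇒≤ 0sη) (<⇒≤ 0sη)))))))
      where 0sη = *-pos 0<s 0<η

  bisect-close : ∀ {η} p m q n → 0ℚ < η → ∣ p - q ∣ < η * η → width p m < η → width q n < η →
    ∣ bisect p m - bisect q n ∣ < η + η
  bisect-close {η} p m q n 0<η h wp wq = ∣p∣<
    (lem p m q n (bisect-near p m q n 0<η h) wq)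
    (subst (_< η + η) (solve 2 (λ r s → s :- r := :- (r :- s)) refl (bisect p m) (bisect q n))
      (lem q n p m (bisect-near q n p m 0<η (subst (_< η * η) (∣p-q∣≡∣q-p∣ p q) h)) wp))
    where
    lem : ∀ p m q n → bisect p m < bisect q n + width q n + η → width q n < η → bisect p m - bisect q n < η + η
    lem p m q n a b = 0<⇒< (subst (0ℚ <_)
      (solve 4 (λ r s w η → (s :+ w :+ η :- r) :+ (η :- w) := η :+ η :- (r :- s)) refl (bisect p m) (bisect q n) (width q n) η)
      (+-pos (<⇒0< a) (<⇒0< b)))

  bisect-bounded : ∀ {q K} n → 0ℚ < K → q < K → bisect q n ≤ K + 1ℚ
  bisect-bounded {q} {K} n 0<K q<K with bisect-below q n
  ... | inj₁ z = subst (_≤ K + 1ℚ) (sym z) (<⇒≤ (+-pos 0<K 0<1))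
  ... | inj₂ h = <⇒≤ (sq-cancel-< (<⇒≤ (+-pos 0<K 0<1)) (<-trans (≤-<-trans h q<K) (0<⇒< (subst (0ℚ <_)
    (solve 1 (λ K → K :* K :+ (K :+ con 1ℚ) := (K :+ con 1ℚ) :* (K :+ con 1ℚ) :- K) refl K)
    (+-pos (*-pos 0<K 0<K) (+-pos 0<K 0<1))))))

  width-bounded : ∀ {q K} n → ∣ q ∣ < K → width q n ≤ (K + 1ℚ) * ½^ n
  width-bounded n h = *-monoʳ-≤-nonNeg (½^ n) {{nonNegative (<⇒≤ (½^-pos n))}} (+-monoˡ-≤ 1ℚ (<⇒≤ h))

  bisect-square-close : ∀ {q K ε} n → 0ℚ < K → 0ℚ < ε → ∣ q ∣ < K → - q < ε → width q n < 1ℚ →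
    width q n * ((K + 1ℚ) + (K + 1ℚ) + 1ℚ) < ε → ∣ bisect q n * bisect q n - q ∣ < ε
  bisect-square-close {q} {K} {ε} n 0<K 0<ε ∣q∣<K -q<ε w<1 small = ∣p∣< upper lower
    where
    r = bisect q n
    w = width q n
    r≤ = bisect-bounded n 0<K (≤-<-trans (p≤∣p∣ q) ∣q∣<K)
    upper : r * r - q < ε
    upper with bisect-below q n
    ... | inj₁ z = subst (_< ε) (trans (solve 1 (λ q → :- q := con 0ℚ :* con 0ℚ :- q) refl q)
                     (cong (λ z → z * z - q) (sym z))) -q<ε
    ... | inj₂ h = ≤-<-trans (0≤⇒≤ (subst (0ℚ ≤_)
                     (solve 2 (λ r q → q :- r :* r := con 0ℚ :- (r :* r :- q)) refl r q) (≤⇒0≤ h))) 0<ε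
    lower : - (r * r - q) < ε
    lower = <-trans (0<⇒< (subst (0ℚ <_)
        (solve 3 (λ r w q → (r :+ w) :* (r :+ w) :- q := w :* (r :+ r :+ w) :- (:- (r :* r :- q))) refl r w q)
        (<⇒0< (bisect-above q n))))
      (≤-<-trans (*-monoˡ-≤-nonNeg w {{nonNegative (<⇒≤ (width-pos q n))}}
         (+-mono-≤ (+-mono-≤ r≤ r≤) (<⇒≤ w<1))) small)

  ⊓-pos : ∀ {p q} → 0ℚ < p → 0ℚ < q → 0ℚ < p ⊓ q
  ⊓-pos {p} {q} a b with ≤-total p q
  ... | inj₁ h = subst (0ℚ <_) (sym (p≤q⇒p⊓q≡p h)) a
  ... | inj₂ h = subst (0ℚ <_) (sym (p≥q⇒p⊓q≡q h)) b

  bisect-lower : ∀ {q ε} n → 0ℚ < ε → ε ≤ q → width q n < ½ * (ε ⊓ 1ℚ) → ½ * (ε ⊓ 1ℚ) ≤ bisect q n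
  bisect-lower {q} {ε} n 0<ε ε≤q w< = <⇒≤ (0<⇒< (subst (0ℚ <_)
      (trans (solve 4 (λ r w h δ → (r :+ w :- δ) :+ (h :- w) := h :- δ :+ r) refl r w (½ * δ) δ)
        (solve 2 (λ r δ → con ½ :* δ :- δ :+ r := r :- con ½ :* δ) refl r δ))
      (+-pos (<⇒0< δ<) (<⇒0< w<))))
    where
    δ = ε ⊓ 1ℚ
    r = bisect q n
    w = width q n
    0<δ = ⊓-pos 0<ε 0<1
    δ< : δ < r + w
    δ< = sq-cancel-< (+-nonneg (bisect-nonneg q n) (<⇒≤ (width-pos q n)))
      (≤-<-trans (≤-trans (*-mono-nonneg (<⇒≤ 0<δ) (<⇒≤ 0<δ) (p⊓q≤p ε 1ℚ) (p⊓q≤q ε 1ℚ))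
          (≤-trans (≤-reflexive (*-identityʳ ε)) ε≤q)) (bisect-above q n))

  quartic-lower : ∀ {α ε} ξ → 0ℚ < ε → (- 1ℚ) + ε ≤ α →
    ε ⊓ 1ℚ ≤ ξ * (ξ * (ξ * (ξ * 1ℚ))) + (1ℚ + 1ℚ) * α * (ξ * (ξ * 1ℚ)) + 1ℚ
  quartic-lower {α} {ε} ξ 0<ε h = 0≤⇒≤ (subst (0ℚ ≤_)
      (solve 3 (λ ξ α δ → (con 1ℚ :- δ) :* ((ξ :* ξ :- con 1ℚ) :* (ξ :* ξ :- con 1ℚ)) :+ δ :* ((ξ :* ξ) :* (ξ :* ξ))
           :+ ((ξ :* ξ) :* (α :+ con 1ℚ :- δ) :+ (ξ :* ξ) :* (α :+ con 1ℚ :- δ))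
         := ξ :* (ξ :* (ξ :* (ξ :* con 1ℚ))) :+ (con 1ℚ :+ con 1ℚ) :* α :* (ξ :* (ξ :* con 1ℚ)) :+ con 1ℚ :- δ) refl ξ α δ)
      (+-nonneg (+-nonneg (*-nonneg (≤⇒0≤ (p⊓q≤q ε 1ℚ)) (sq-nonneg (ξ * ξ - 1ℚ))) (*-nonneg (<⇒≤ (⊓-pos 0<ε 0<1)) (sq-nonneg (ξ * ξ))))
        (+-nonneg t t)))
    where
    δ = ε ⊓ 1ℚ
    δ≤ : 0ℚ ≤ α + 1ℚ - δ
    δ≤ = ≤⇒0≤ (≤-trans (p⊓q≤p ε 1ℚ) (0≤⇒≤ {ε} {α + 1ℚ} (subst (0ℚ ≤_)
           (solve 2 (λ α ε → α :- (:- con 1ℚ :+ ε) := α :+ con 1ℚ :- ε) refl α ε) (≤⇒0≤ h))))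
    t = *-nonneg (sq-nonneg ξ) δ≤

  quadratic-lower : ∀ {α ε} ξ → (- 1ℚ) + ε ≤ α → ε ≤ 1ℚ + α + (1ℚ + 1ℚ) * (ξ * (ξ * 1ℚ))
  quadratic-lower {α} {ε} ξ h = 0≤⇒≤ (subst (0ℚ ≤_)
    (solve 3 (λ ξ α ε → (α :- (:- con 1ℚ :+ ε)) :+ (ξ :* ξ :+ ξ :* ξ)
       := con 1ℚ :+ α :+ (con 1ℚ :+ con 1ℚ) :* (ξ :* (ξ :* con 1ℚ)) :- ε) refl ξ α ε)
    (+-nonneg (≤⇒0≤ h) (+-nonneg (sq-nonneg ξ) (sq-nonneg ξ))))

  square+1-lower : ∀ ξ → 1ℚ ≤ ξ * (ξ * 1ℚ) + 1ℚ
  square+1-lower ξ = 0≤⇒≤ (subst (0ℚ ≤_)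
    (solve 1 (λ ξ → ξ :* ξ := ξ :* (ξ :* con 1ℚ) :+ con 1ℚ :- con 1ℚ) refl ξ) (sq-nonneg ξ))

  split-< : ∀ {p q ε} → p < ½ * ε → q < ½ * ε → p + q < ε
  split-< {p} {q} {ε} a b = subst (p + q <_) (halves ε) (+-mono-< a b)

  cancel : ∀ p q → p + (q - p) ≡ q
  cancel = solve 2 (λ p q → p :+ (q :- p) := q) refl

  ∣q-q∣≡0 : ∀ q → ∣ q - q ∣ ≡ 0ℚ
  ∣q-q∣≡0 q = cong ∣_∣ (+-inverseʳ q)

  half-< : ∀ {ε} → 0ℚ < ε → ½ * ε < ε
  half-< {ε} 0<ε = subst (½ * ε <_) (halves ε) (subst (_< ½ * ε + ½ * ε) (+-identityʳ _) (+-monoʳ-< (½ * ε) (half-pos 0<ε)))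

  away : ∀ p {ε} → p + ε ≤ 0ℚ → ε ≤ ∣ p ∣
  away p {ε} h = ≤-trans (0≤⇒≤ (subst (0ℚ ≤_) (solve 2 (λ p ε → con 0ℚ :- (p :+ ε) := :- p :- ε) refl p ε) (≤⇒0≤ h)))
    (≤-trans (p≤∣p∣ (- p)) (≤-reflexive (∣-p∣≡∣p∣ p)))

  neg-< : ∀ {q ε} → 0ℚ ≤ q + ½ * ε → 0ℚ < ε → - q < ε
  neg-< {q} {ε} h 0<ε = ≤-<-trans (0≤⇒≤ (subst (0ℚ ≤_)
    (solve 2 (λ q e → q :+ e := e :- (:- q)) refl q (½ * ε)) h)) (half-< 0<ε)

open import Algebra.Bundles using (CommutativeRing)
open import Algebra.Structures using (IsCommutativeRing)
open import Data.Nat.Base as ℕ using (ℕ; zero; suc; _∸_)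
import Data.Nat.Properties as ℕₚ
open import Data.Nat.Combinatorics using (_C_)
open import Data.Fin.Base using (toℕ)
open import Data.Rational.Base as ℚ using (ℚ; 0ℚ; 1ℚ; ½; ∣_∣)
import Data.Rational.Properties as ℚₚ
open import Data.Product.Base using (_×_; _,_; ∃-syntax)
open import Data.Sum.Base using (_⊎_; inj₁; inj₂)
open import Level using (0ℓ)
open import Relation.Nullary.Negation.Core using (contradiction)
open import Relation.Binary.Structures using (IsEquivalence)
open import Relation.Binary.PropositionalEquality.Core as ≡
  using (_≡_; refl; sym; trans; cong; cong₂; subst; subst₂)

private module L = ℚ-lemmas

Eventually : (ℕ → Set) → Set
Eventually P = ∃[ N ] ∀ n → N ℕ.≤ n → P n

ev-map : ∀ {P Q : ℕ → Set} → (∀ n → P n → Q n) → Eventually P → Eventually Q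
ev-map f (N , h) = N , λ n N≤n → f n (h n N≤n)

ev-× : ∀ {P Q : ℕ → Set} → Eventually P → Eventually Q → Eventually (λ n → P n × Q n)
ev-× (M , h) (N , k) = M ℕ.⊔ N , λ n le →
  h n (ℕₚ.≤-trans (ℕₚ.m≤m⊔n M N) le) , k n (ℕₚ.≤-trans (ℕₚ.m≤n⊔m M N) le)

Cauchy : (ℕ → ℚ) → Set
Cauchy u = ∀ ε → 0ℚ ℚ.< ε → ∃[ N ] ∀ m n → N ℕ.≤ m → N ℕ.≤ n → ∣ u m ℚ.- u n ∣ ℚ.< ε

-- The Cauchy reals: Cauchy sequences of rationals (carrying a modulus of
-- convergence), compared by the setoid equality _≈_ below.
record ℝ : Set where
  no-eta-equality
  constructor mkℝ
  field
    seq    : ℕ → ℚ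
    cauchy : Cauchy seq

open ℝ public

infix 4 _≈_ _<_ _≤_ _#_

record _≈_ (x y : ℝ) : Set where
  constructor mk≈
  field close : ∀ ε → 0ℚ ℚ.< ε → Eventually (λ n → ∣ seq x n ℚ.- seq y n ∣ ℚ.< ε)

record _<_ (x y : ℝ) : Set where
  constructor mk<
  field gap : ∃[ ε ] 0ℚ ℚ.< ε × Eventually (λ n → seq x n ℚ.+ ε ℚ.≤ seq y n)

record _≤_ (x y : ℝ) : Set where
  constructor mk≤
  field bound : ∀ ε → 0ℚ ℚ.< ε → Eventually (λ n → seq x n ℚ.≤ seq y n ℚ.+ ε)

open _≈_ public
open _<_ public
open _≤_ public

_#_ : ℝ → ℝ → Set
x # y = x < y ⊎ y < x

bounded : ∀ x → ∃[ K ] 0ℚ ℚ.< K × Eventually (λ n → ∣ seq x n ∣ ℚ.< K)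
bounded x = let N , h = cauchy x 1ℚ L.0<1 in
  ∣ seq x N ∣ ℚ.+ 1ℚ , L.∣q∣+1-pos (seq x N) , N , λ n N≤n →
  ℚₚ.≤-<-trans
    (subst (ℚ._≤ ∣ seq x N ∣ ℚ.+ ∣ seq x n ℚ.- seq x N ∣)
      (cong ∣_∣ (L.cancel (seq x N) (seq x n)))
      (ℚₚ.∣p+q∣≤∣p∣+∣q∣ (seq x N) (seq x n ℚ.- seq x N)))
    (ℚₚ.+-monoʳ-< ∣ seq x N ∣ (h n N N≤n ℕₚ.≤-refl))

fromℚ : ℚ → ℝ
seq    (fromℚ q) _ = q
cauchy (fromℚ q) ε 0<ε = 0 , λ _ _ _ _ → subst (ℚ._< ε) (sym (L.∣q-q∣≡0 q)) 0<ε

0ℝ 1ℝ : ℝ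
0ℝ = fromℚ 0ℚ
1ℝ = fromℚ 1ℚ

infixl 6 _+_ _-_
infixl 7 _*_
infix  8 -_

_+_ : ℝ → ℝ → ℝ
seq    (x + y) n = seq x n ℚ.+ seq y n
cauchy (x + y) ε 0<ε =
  let M , h = cauchy x (½ ℚ.* ε) (L.half-pos 0<ε)
      N , k = cauchy y (½ ℚ.* ε) (L.half-pos 0<ε)
  in M ℕ.⊔ N , λ m n p q → ℚₚ.≤-<-trans
  (L.∣∣-+ (seq x m) (seq y m) (seq x n) (seq y n))
  (L.split-< (h m n (ℕₚ.m⊔n≤o⇒m≤o M N p) (ℕₚ.m⊔n≤o⇒m≤o M N q))
             (k m n (ℕₚ.m⊔n≤o⇒n≤o M N p) (ℕₚ.m⊔n≤o⇒n≤o M N q)))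

-_ : ℝ → ℝ
seq    (- x) n = ℚ.- seq x n
cauchy (- x) ε 0<ε = let N , h = cauchy x ε 0<ε in
  N , λ m n p q → subst (ℚ._< ε) (sym (L.∣∣-neg (seq x m) (seq x n))) (h m n p q)

_-_ : ℝ → ℝ → ℝ
x - y = x + - y

_*_ : ℝ → ℝ → ℝ
seq    (x * y) n = seq x n ℚ.* seq y n
cauchy (x * y) ε 0<ε =
  let A , 0<A , M , h = bounded x
      D , 0<D , N , k = bounded y
      δ , 0<δ , eq = L.quotient (L.half-pos 0<ε) (L.+-pos 0<A 0<D)
      M′ , h′ = cauchy x δ 0<δ
      N′ , k′ = cauchy y δ 0<δ
  in (M ℕ.⊔ N) ℕ.⊔ (M′ ℕ.⊔ N′) , λ m n p q →
  let p₁ = ℕₚ.m⊔n≤o⇒m≤o (M ℕ.⊔ N) (M′ ℕ.⊔ N′) p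
      q₁ = ℕₚ.m⊔n≤o⇒m≤o (M ℕ.⊔ N) (M′ ℕ.⊔ N′) q
      p₂ = ℕₚ.m⊔n≤o⇒n≤o (M ℕ.⊔ N) (M′ ℕ.⊔ N′) p
      q₂ = ℕₚ.m⊔n≤o⇒n≤o (M ℕ.⊔ N) (M′ ℕ.⊔ N′) q
  in ℚₚ.≤-<-trans
    (L.∣∣-*-small {seq x m} {seq y m} {seq x n} {seq y n} 0<A 0<D
      (h m (ℕₚ.m⊔n≤o⇒m≤o M N p₁)) (k n (ℕₚ.m⊔n≤o⇒n≤o M N q₁))
      (k′ m n (ℕₚ.m⊔n≤o⇒n≤o M′ N′ p₂) (ℕₚ.m⊔n≤o⇒n≤o M′ N′ q₂))
      (h′ m n (ℕₚ.m⊔n≤o⇒m≤o M′ N′ p₂) (ℕₚ.m⊔n≤o⇒m≤o M′ N′ q₂)))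
    (subst (ℚ._< ε) (sym eq) (L.half-< 0<ε))

pointwise : ∀ {x y} → (∀ n → seq x n ≡ seq y n) → x ≈ y
close (pointwise {x} {y} h) ε 0<ε = 0 , λ n _ → subst (ℚ._< ε)
  (sym (trans (cong (λ z → ∣ z ℚ.- seq y n ∣) (h n)) (L.∣q-q∣≡0 (seq y n)))) 0<ε

≈-refl : ∀ {x} → x ≈ x
≈-refl {x} = pointwise {x} {x} (λ _ → refl)

≈-sym : ∀ {x y} → x ≈ y → y ≈ x
close (≈-sym {x} {y} h) ε 0<ε =
  ev-map (λ n → subst (ℚ._< ε) (L.∣p-q∣≡∣q-p∣ (seq x n) (seq y n))) (close h ε 0<ε)

≈-trans : ∀ {x y z} → x ≈ y → y ≈ z → x ≈ z
close (≈-trans {x} {y} {z} h k) ε 0<ε =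
  ev-map (λ n (a , b) → ℚₚ.≤-<-trans (L.∣∣-triangle (seq x n) (seq y n) (seq z n)) (L.split-< a b))
    (ev-× (close h (½ ℚ.* ε) (L.half-pos 0<ε)) (close k (½ ℚ.* ε) (L.half-pos 0<ε)))

+-cong : ∀ {x x′ y y′} → x ≈ x′ → y ≈ y′ → x + y ≈ x′ + y′
close (+-cong {x} {x′} {y} {y′} h k) ε 0<ε =
  ev-map (λ n (a , b) → ℚₚ.≤-<-trans (L.∣∣-+ (seq x n) (seq y n) (seq x′ n) (seq y′ n)) (L.split-< a b))
    (ev-× (close h (½ ℚ.* ε) (L.half-pos 0<ε)) (close k (½ ℚ.* ε) (L.half-pos 0<ε)))

-‿cong : ∀ {x y} → x ≈ y → - x ≈ - y
close (-‿cong {x} {y} h) ε 0<ε =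
  ev-map (λ n → subst (ℚ._< ε) (sym (L.∣∣-neg (seq x n) (seq y n)))) (close h ε 0<ε)

*-cong : ∀ {x x′ y y′} → x ≈ x′ → y ≈ y′ → x * y ≈ x′ * y′
close (*-cong {x} {x′} {y} {y′} h k) ε 0<ε =
  let A , 0<A , evA = bounded x
      D , 0<D , evD = bounded y′
      δ , 0<δ , eq = L.quotient (L.half-pos 0<ε) (L.+-pos 0<A 0<D)
  in ev-map (λ n ((a , d) , (p , q)) → ℚₚ.≤-<-trans
      (L.∣∣-*-small {seq x n} {seq y n} {seq x′ n} {seq y′ n} 0<A 0<D a d q p)
      (subst (ℚ._< ε) (sym eq) (L.half-< 0<ε)))
    (ev-× (ev-× evA evD) (ev-× (close h δ 0<δ) (close k δ 0<δ)))

≈-isEquivalence : IsEquivalence _≈_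
≈-isEquivalence = record { refl = ≈-refl ; sym = ≈-sym ; trans = ≈-trans }

+-*-isCommutativeRing : IsCommutativeRing _≈_ _+_ _*_ -_ 0ℝ 1ℝ
+-*-isCommutativeRing = record
  { isRing = record
    { +-isAbelianGroup = record
      { isGroup = record
        { isMonoid = record
          { isSemigroup = record
            { isMagma = record { isEquivalence = ≈-isEquivalence ; ∙-cong = +-cong }
            ; assoc = λ x y z → pointwise λ n → ℚₚ.+-assoc (seq x n) (seq y n) (seq z n)
            }
          ; identity = (λ x → pointwise λ n → ℚₚ.+-identityˡ (seq x n))
                     , (λ x → pointwise λ n → ℚₚ.+-identityʳ (seq x n))
          }
        ; inverse = (λ x → pointwise λ n → ℚₚ.+-inverseˡ (seq x n))
                  , (λ x → pointwise λ n → ℚₚ.+-inverseʳ (seq x n))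
        ; ⁻¹-cong = -‿cong
        }
      ; comm = λ x y → pointwise λ n → ℚₚ.+-comm (seq x n) (seq y n)
      }
    ; *-cong = *-cong
    ; *-assoc = λ x y z → pointwise λ n → ℚₚ.*-assoc (seq x n) (seq y n) (seq z n)
    ; *-identity = (λ x → pointwise λ n → ℚₚ.*-identityˡ (seq x n))
                 , (λ x → pointwise λ n → ℚₚ.*-identityʳ (seq x n))
    ; distrib = (λ x y z → pointwise λ n → ℚₚ.*-distribˡ-+ (seq x n) (seq y n) (seq z n))
              , (λ x y z → pointwise λ n → ℚₚ.*-distribʳ-+ (seq x n) (seq y n) (seq z n))
    }
  ; *-comm = λ x y → pointwise λ n → ℚₚ.*-comm (seq x n) (seq y n)
  }

ℝ-commutativeRing : CommutativeRing 0ℓ 0ℓ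
ℝ-commutativeRing = record { isCommutativeRing = +-*-isCommutativeRing }

open import Algebra.Properties.Semiring.Exp (CommutativeRing.semiring ℝ-commutativeRing)
  public using (_^_)
open import Algebra.Properties.Semiring.Sum (CommutativeRing.semiring ℝ-commutativeRing)
  public using (sum⁺-syntax)
open import Algebra.Properties.Semiring.Mult (CommutativeRing.semiring ℝ-commutativeRing)
  public using () renaming (_×_ to _·_)

pos : ∀ {x} → (∃[ ε ] 0ℚ ℚ.< ε × Eventually (λ n → ε ℚ.≤ seq x n)) → 0ℝ < x
pos {x} (ε , 0<ε , ev) = mk< (ε , 0<ε , ev-map (λ n → subst (ℚ._≤ seq x n) (sym (ℚₚ.+-identityˡ ε))) ev)

pos⁻¹ : ∀ {x} → 0ℝ < x → ∃[ ε ] 0ℚ ℚ.< ε × Eventually (λ n → ε ℚ.≤ seq x n)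
pos⁻¹ {x} (mk< (ε , 0<ε , ev)) = ε , 0<ε , ev-map (λ n → subst (ℚ._≤ seq x n) (ℚₚ.+-identityˡ ε)) ev

0<1 : 0ℝ < 1ℝ
0<1 = pos (1ℚ , L.0<1 , 0 , λ _ _ → ℚₚ.≤-refl)

+-pos : ∀ {x y} → 0ℝ < x → 0ℝ < y → 0ℝ < x + y
+-pos {x} {y} 0<x 0<y =
  let ε , 0<ε , h = pos⁻¹ 0<x
      δ , 0<δ , k = pos⁻¹ 0<y
  in pos (ε ℚ.+ δ , L.+-pos 0<ε 0<δ , ev-map (λ n (a , b) → ℚₚ.+-mono-≤ a b) (ev-× h k))

*-pos : ∀ {x y} → 0ℝ < x → 0ℝ < y → 0ℝ < x * y
*-pos {x} {y} 0<x 0<y =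
  let ε , 0<ε , h = pos⁻¹ 0<x
      δ , 0<δ , k = pos⁻¹ 0<y
  in pos (ε ℚ.* δ , L.*-pos 0<ε 0<δ ,
       ev-map (λ n (a , b) → L.*-mono-nonneg (ℚₚ.<⇒≤ 0<ε) (ℚₚ.<⇒≤ 0<δ) a b) (ev-× h k))

^-pos : ∀ {x} n → 0ℝ < x → 0ℝ < x ^ n
^-pos zero    0<x = 0<1
^-pos (suc n) 0<x = *-pos 0<x (^-pos n 0<x)

#0⇒away : ∀ {x} → x # 0ℝ → ∃[ ε ] 0ℚ ℚ.< ε × Eventually (λ n → ε ℚ.≤ ∣ seq x n ∣)
#0⇒away {x} (inj₁ (mk< (ε , 0<ε , ev))) = ε , 0<ε , ev-map (λ n → L.away (seq x n)) ev
#0⇒away {x} (inj₂ 0<x) = let ε , 0<ε , ev = pos⁻¹ 0<x in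
  ε , 0<ε , ev-map (λ n h → ℚₚ.≤-trans h (L.p≤∣p∣ (seq x n))) ev

-- The sequence of inverses does not depend on the proof of x # 0ℝ, which only
-- supplies its Cauchy modulus.
infix 8 _⁻¹[_]
_⁻¹[_] : (x : ℝ) → x # 0ℝ → ℝ
seq    (x ⁻¹[ x#0 ]) n = L.recip (seq x n)
cauchy (x ⁻¹[ x#0 ]) δ 0<δ =
  let ε , 0<ε , M , h = #0⇒away x#0
      N , k = cauchy x (δ ℚ.* (ε ℚ.* ε)) (L.*-pos 0<δ (L.*-pos 0<ε 0<ε))
  in M ℕ.⊔ N , λ m n p q → L.recip-close {seq x m} {seq x n} 0<ε 0<δ
  (h m (ℕₚ.m⊔n≤o⇒m≤o M N p)) (h n (ℕₚ.m⊔n≤o⇒m≤o M N q))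
  (k m n (ℕₚ.m⊔n≤o⇒n≤o M N p) (ℕₚ.m⊔n≤o⇒n≤o M N q))

⁻¹-inverseʳ : ∀ x (x#0 : x # 0ℝ) → x * (x ⁻¹[ x#0 ]) ≈ 1ℝ
close (⁻¹-inverseʳ x x#0) ε 0<ε =
  let δ , 0<δ , ev = #0⇒away x#0 in ev-map (λ n h → subst (ℚ._< ε)
  (sym (trans (cong (λ z → ∣ z ℚ.- 1ℚ ∣) (L.recip-inverseʳ (seq x n) (L.≤∣p∣⇒≢0 0<δ h))) (L.∣q-q∣≡0 1ℚ))) 0<ε) ev

infixl 7 _/_[_]
_/_[_] : (x y : ℝ) → y # 0ℝ → ℝ
x / y [ y#0 ] = x * (y ⁻¹[ y#0 ])

pos⇒#0 : ∀ {x} → 0ℝ < x → x # 0ℝ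
pos⇒#0 = inj₂

small-width : ∀ x {ε} → 0ℚ ℚ.< ε → Eventually (λ n → L.width (seq x n) n ℚ.< ε)
small-width x 0<ε = let K , 0<K , h = bounded x in ev-map (λ n (a , b) → ℚₚ.≤-<-trans (L.width-bounded n a) b)
  (ev-× h (L.½^-small (L.+-pos 0<K L.0<1) 0<ε))

-- Total; the value is the square root when 0ℝ ≤ x (√-nonneg, √-square), else 0.
√ : ℝ → ℝ
seq    (√ x) n = L.bisect (seq x n) n
cauchy (√ x) ε 0<ε =
  let η = ½ ℚ.* ε
      0<η = L.half-pos 0<ε
      M , h = small-width x 0<η
      N , k = cauchy x (η ℚ.* η) (L.*-pos 0<η 0<η)
  in M ℕ.⊔ N , λ m n p q →
  subst (∣ L.bisect (seq x m) m ℚ.- L.bisect (seq x n) n ∣ ℚ.<_) (L.halves ε)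
    (L.bisect-close (seq x m) m (seq x n) n (L.half-pos 0<ε)
      (k m n (ℕₚ.m⊔n≤o⇒n≤o M N p) (ℕₚ.m⊔n≤o⇒n≤o M N q))
      (h m (ℕₚ.m⊔n≤o⇒m≤o M N p)) (h n (ℕₚ.m⊔n≤o⇒m≤o M N q)))

√-nonneg : ∀ x → 0ℝ ≤ √ x
bound (√-nonneg x) ε 0<ε = 0 , λ n _ → L.+-nonneg (L.bisect-nonneg (seq x n) n) (ℚₚ.<⇒≤ 0<ε)

√-square : ∀ {x} → 0ℝ ≤ x → √ x * √ x ≈ x
close (√-square {x} 0≤x) ε 0<ε =
  let K , 0<K , evK = bounded x
      B = (K ℚ.+ 1ℚ) ℚ.+ (K ℚ.+ 1ℚ) ℚ.+ 1ℚ
      0<K+1 = L.+-pos 0<K L.0<1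
      0<B = L.+-pos (L.+-pos 0<K+1 0<K+1) L.0<1
      δ , 0<δ , eq = L.quotient 0<ε 0<B
  in ev-map
    (λ n ((a , b) , (c , d)) → L.bisect-square-close n 0<K 0<ε a (L.neg-< b 0<ε) c
      (subst (L.width (seq x n) n ℚ.* B ℚ.<_) (trans (ℚₚ.*-comm δ B) eq)
        (ℚₚ.*-monoˡ-<-pos B {{ℚ.positive 0<B}} d)))
    (ev-× (ev-× evK (bound 0≤x (½ ℚ.* ε) (L.half-pos 0<ε)))
          (ev-× (small-width x L.0<1) (small-width x 0<δ)))

√-pos : ∀ {x} → 0ℝ < x → 0ℝ < √ x
√-pos {x} 0<x =
  let ε , 0<ε , ev = pos⁻¹ 0<x
      0<δ = L.half-pos (L.⊓-pos 0<ε L.0<1)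
  in pos (½ ℚ.* (ε ℚ.⊓ 1ℚ) , 0<δ ,
    ev-map (λ n (a , b) → L.bisect-lower n 0<ε a b) (ev-× ev (small-width x 0<δ)))

2ℝ : ℝ
2ℝ = 1ℝ + 1ℝ

0<2 : 0ℝ < 2ℝ
0<2 = +-pos 0<1 0<1

quartic-pos : ∀ {a} → - 1ℝ < a → ∀ x → 0ℝ < x ^ 4 + 2ℝ * a * x ^ 2 + 1ℝ
quartic-pos (mk< (ε , 0<ε , ev)) x = pos (ε ℚ.⊓ 1ℚ , L.⊓-pos 0<ε L.0<1 ,
  ev-map (λ n → L.quartic-lower (seq x n) 0<ε) ev)

y²+1-pos : ∀ y → 0ℝ < y ^ 2 + 1ℝ
y²+1-pos y = pos (1ℚ , L.0<1 , 0 , λ n _ → L.square+1-lower (seq y n))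

1+a+2y²-pos : ∀ {a} → - 1ℝ < a → ∀ y → 0ℝ < 1ℝ + a + 2ℝ * y ^ 2
1+a+2y²-pos (mk< (ε , 0<ε , ev)) y = pos (ε , 0<ε , ev-map (λ n → L.quadratic-lower (seq y n)) ev)

Q : ℕ → (a : ℝ) → - 1ℝ < a → ℝ → ℝ
Q m a -1<a x =
  ((x ^ 4 + 2ℝ * a * x ^ 2 + 1ℝ) ^ suc m) ⁻¹[ pos⇒#0 (^-pos (suc m) (quartic-pos -1<a x)) ]

Q₁ : ℕ → (a : ℝ) → - 1ℝ < a → ℝ → ℝ
Q₁ m a -1<a y =
  (Q′ (y + s) + Q′ (y - s)) + (y / s [ pos⇒#0 (√-pos (y²+1-pos y)) ]) * (Q′ (y + s) - Q′ (y - s))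
  where
  s  = √ (y ^ 2 + 1ℝ)
  Q′ = Q m a -1<a

T : ℕ → ℝ → ℝ
T m y = ∑[ k ≤ m ] (((m ℕ.+ toℕ k) C (m ∸ toℕ k)) · (y ^ (2 ℕ.* toℕ k)))

{-# OPTIONS --safe #-}
-- With s = √(y² + 1), the points u = y + s and v = y - s satisfy uv = -1 and
-- u² + v² = 4y² + 2, so the quartic x⁴ + 2ax² + 1 takes the value 2cu² at u and
-- 2cv² at v, where c = 1 + a + 2y².  Hence (2c)^(m+1) Q(u) = v^(2m+2), symmetrically
-- for v, and s Q₁ = u Q(u) - v Q(v) becomes
-- (2c)^(m+1) s Q₁ = u^(2m+1) - v^(2m+1).
-- The right-hand side is (u - v) F_{2m+1}(u + v) = 2s T_m(2y), where the F_n are the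
-- Fibonacci polynomials.
module Submission where

open import Defs
open import Algebra.Bundles using (CommutativeRing)
import Algebra.Properties.CommutativeSemiring.Exp as CommutativeExp
import Algebra.Properties.Semiring.Exp as Exp
import Algebra.Properties.Semiring.Mult as Mult
import Algebra.Properties.Semiring.Sum as Sum
open import Data.Fin.Base using (Fin; zero; suc; toℕ)
open import Data.Fin.Properties using (toℕ≤pred[n])
open import Data.Nat.Base as ℕ using (ℕ; zero; suc; _∸_; s≤s)
import Data.Nat.Properties as ℕₚ
import Data.Nat.Tactic.RingSolver as ℕ-Solver
open import Data.Nat.Combinatorics using (_C_; nCk≡nC[n∸k]; k>n⇒nCk≡0; nCk+nC[k+1]≡[n+1]C[k+1])
open import Data.Product.Base using (_×_; _,_; proj₁)
open import Data.Rational.Base using (1ℚ)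
import Data.Rational.Properties as ℚₚ
open import Data.Rational.Solver using (module +-*-Solver)
open +-*-Solver
open import Function.Base using (_∘_)
open import Relation.Binary.PropositionalEquality.Core as ≡ using (_≡_)

private
  module R = CommutativeRing ℝ-commutativeRing
  module E = Exp R.semiring
  module CE = CommutativeExp R.commutativeSemiring
  module M = Mult R.semiring
  module S = Sum R.semiring

open import Relation.Binary.Reasoning.Setoid R.setoid

-- Cancellation and division in the Cauchy reals.

<⇒≤ : ∀ {x} → 0ℝ < x → 0ℝ ≤ x
bound (<⇒≤ {x} 0<x) ε 0<ε =
  let δ , 0<δ , ev = pos⁻¹ 0<x in
  ev-map (λ n δ≤xₙ → ℚ-lemmas.+-nonneg (ℚₚ.≤-trans (ℚₚ.<⇒≤ 0<δ) δ≤xₙ) (ℚₚ.<⇒≤ 0<ε)) ev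

*-cancelˡ-#0 : ∀ {r} → r # 0ℝ → ∀ {x y} → r * x ≈ r * y → x ≈ y
*-cancelˡ-#0 {r} r#0 {x} {y} rx≈ry = begin
  x               ≈⟨ undo x ⟨
  r⁻¹ * (r * x)   ≈⟨ R.*-congˡ rx≈ry ⟩
  r⁻¹ * (r * y)   ≈⟨ undo y ⟩
  y               ∎
  where
  r⁻¹ = r ⁻¹[ r#0 ]
  undo : ∀ z → r⁻¹ * (r * z) ≈ z
  undo z = begin
    r⁻¹ * (r * z)  ≈⟨ R.*-assoc r⁻¹ r z ⟨
    r⁻¹ * r * z    ≈⟨ R.*-congʳ (R.trans (R.*-comm r⁻¹ r) (⁻¹-inverseʳ r r#0)) ⟩
    1ℝ * z         ≈⟨ R.*-identityˡ z ⟩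
    z              ∎

*-/-cancel : ∀ x y (y#0 : y # 0ℝ) → y * (x / y [ y#0 ]) ≈ x
*-/-cancel x y y#0 = begin
  y * (x * y ⁻¹[ y#0 ])  ≈⟨ R.*-congˡ (R.*-comm x (y ⁻¹[ y#0 ])) ⟩
  y * (y ⁻¹[ y#0 ] * x)  ≈⟨ R.*-assoc y (y ⁻¹[ y#0 ]) x ⟨
  y * y ⁻¹[ y#0 ] * x    ≈⟨ R.*-congʳ (⁻¹-inverseʳ y y#0) ⟩
  1ℝ * x                 ≈⟨ R.*-identityˡ x ⟩
  x                      ∎

sum≈head : ∀ {n} (f : Fin (suc n) → ℝ) → (∀ i → f (suc i) ≈ 0ℝ) → S.sum f ≈ f zero
sum≈head {n} f f∘suc≈0 = begin
  f zero + S.sum (f ∘ suc)  ≈⟨ R.+-congˡ (S.sum-cong-≋ f∘suc≈0) ⟩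
  f zero + S.sum {n} (λ _ → 0ℝ)  ≈⟨ R.+-congˡ (S.sum-replicate-zero n) ⟩
  f zero + 0ℝ               ≈⟨ R.+-identityʳ (f zero) ⟩
  f zero                    ∎

-- Binomial sums for the Fibonacci polynomials and their recurrences.

-- Morgan-Voyce polynomials, F_{2m+1}(z) = b m N (z²) and F_{2m+2}(z) = z B m N (z²).
-- Writing the binomials with lower index 2k (resp. 2k+1) makes all terms with k > m
-- vanish, so any N ≥ m may serve as the upper summation bound.

b-term B-term : ℕ → ℝ → ℕ → ℝ
b-term m w k = ((k ℕ.+ m) C (k ℕ.* 2)) · (w ^ k)
B-term m w k = (suc (k ℕ.+ m) C suc (k ℕ.* 2)) · (w ^ k)

b B : ℕ → ℕ → ℝ → ℝ
b m N w = ∑[ k ≤ N ] b-term m w (toℕ k)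
B m N w = ∑[ k ≤ N ] B-term m w (toℕ k)

pascal-· : ∀ n k x → (suc n C suc k) · x ≈ (n C k) · x + (n C suc k) · x
pascal-· n k x = begin
  (suc n C suc k) · x              ≡⟨ ≡.cong (_· x) (nCk+nC[k+1]≡[n+1]C[k+1] n k) ⟨
  (n C k ℕ.+ n C suc k) · x        ≈⟨ M.×-homo-+ x (n C k) (n C suc k) ⟩
  (n C k) · x + (n C suc k) · x    ∎

-- At summation index `k + 1` with `m = 0`, one `s≤s` (for `b`) or two (for `B`) turn this into
-- "upper index below lower index", so only the head of the sum survives.
k+0<1+k*2 : ∀ k → k ℕ.+ 0 ℕ.< suc (k ℕ.* 2)
k+0<1+k*2 k = s≤s (ℕₚ.≤-trans (ℕₚ.≤-reflexive (ℕₚ.+-identityʳ k)) (ℕₚ.m≤m*n k 2))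

b-zero : ∀ N w → b 0 N w ≈ 1ℝ
b-zero N w = R.trans
  (sum≈head {N} (λ k → b-term 0 w (toℕ k)) λ i → M.×-congˡ (k>n⇒nCk≡0 (s≤s (k+0<1+k*2 (toℕ i)))))
  (R.+-identityʳ 1ℝ)

B-zero : ∀ N w → B 0 N w ≈ 1ℝ
B-zero N w = R.trans
  (sum≈head {N} (λ k → B-term 0 w (toℕ k)) λ i →
    M.×-congˡ (k>n⇒nCk≡0 (s≤s (s≤s (k+0<1+k*2 (toℕ i))))))
  (R.+-identityʳ 1ℝ)

-- Pascal's rule term by term. This is F_{2m+4} = z F_{2m+3} + F_{2m+2} with the common factor z
-- removed.
B-suc : ∀ m N w → B (suc m) N w ≈ b (suc m) N w + B m N w
B-suc m N w = R.trans (S.sum-cong-≋ {suc N} (λ i → term (toℕ i)))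
  (S.∑-distrib-+ {suc N} (λ i → b-term (suc m) w (toℕ i)) (λ i → B-term m w (toℕ i)))
  where
  term : ∀ k → B-term (suc m) w k ≈ b-term (suc m) w k + B-term m w k
  term k rewrite ℕₚ.+-suc k m = pascal-· (suc (k ℕ.+ m)) (k ℕ.* 2) (w ^ k)

-- F_{2m+3} = z F_{2m+2} + F_{2m+1} with w = z². Pascal's rule splits the term at `k + 1` into `w`
-- times the `B`-term at `k` and the `b`-term at `k + 1`; this shift is why `B` carries the bound
-- `N` and `b` the bound `suc N`.
b-suc : ∀ m N w → b (suc m) (suc N) w ≈ w * B m N w + b m (suc N) w
b-suc m N w = begin
  -- `t₀` also serves as the head term of `b (suc m)`: both binomials have lower index 0.
  t₀ + S.sum {suc N} (λ i → b-term (suc m) w (suc (toℕ i)))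
    ≈⟨ R.+-congˡ (S.sum-cong-≋ {suc N} (λ i → term (toℕ i))) ⟩
  t₀ + S.sum {suc N} (λ i → w * B-term m w (toℕ i) + b-term m w (suc (toℕ i)))
    ≈⟨ R.+-congˡ (S.∑-distrib-+ {suc N} (λ i → w * B-term m w (toℕ i)) (λ i → b-term m w (suc (toℕ i)))) ⟩
  t₀ + (S.sum {suc N} (λ i → w * B-term m w (toℕ i)) + t)
    ≈⟨ R.+-congˡ (R.+-congʳ (S.*-distribˡ-sum {suc N} w (λ i → B-term m w (toℕ i)))) ⟨
  t₀ + (w * B m N w + t)
    ≈⟨ pointwise (λ n → solve 3 (λ x y z → x :+ (y :+ z) := y :+ (x :+ z)) ≡.refl
         (seq t₀ n) (seq (w * B m N w) n) (seq t n)) ⟩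
  w * B m N w + (t₀ + t) ∎
  where
  t₀ = b-term m w 0
  t = S.sum {suc N} (λ i → b-term m w (suc (toℕ i)))
  term : ∀ k → b-term (suc m) w (suc k) ≈ w * B-term m w k + b-term m w (suc k)
  term k rewrite ℕₚ.+-suc k m = R.trans
    (pascal-· (suc (k ℕ.+ m)) (suc (k ℕ.* 2)) (w * w ^ k))
    (R.+-congʳ (R.sym (M.×-comm-* (suc (k ℕ.+ m) C suc (k ℕ.* 2)) w (w ^ k))))

-- Consequences of uv = -1.

module _ {u v : ℝ} (uv≈-1 : u * v ≈ - 1ℝ) where

  private
    U = u ^ 2
    V = v ^ 2
    w = (u + v) ^ 2

    uv+1≈0 : ∀ x → (u * v + 1ℝ) * x ≈ 0ℝ
    uv+1≈0 x = begin
      (u * v + 1ℝ) * x   ≈⟨ R.*-congʳ (R.+-congʳ uv≈-1) ⟩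
      (- 1ℝ + 1ℝ) * x    ≈⟨ R.*-congʳ (R.-‿inverseˡ 1ℝ) ⟩
      0ℝ * x             ≈⟨ R.zeroˡ x ⟩
      0ℝ                 ∎

    -- The ring solver treats `u` and `v` as independent, so the identities below carry an explicit
    -- multiple of `u * v + 1ℝ`, which is removed here.
    drop : ∀ x y → x + (u * v + 1ℝ) * y ≈ x
    drop x y = R.trans (R.+-congˡ (uv+1≈0 y)) (R.+-identityʳ x)

  -- Binet's formula for the Fibonacci polynomials at u + v, whose characteristic
  -- roots are u and v.
  binet : ∀ m {N} → m ℕ.≤ N →
    (u - v) * b m N w ≈ u * U ^ m - v * V ^ m ×
    (u - v) * (u + v) * B m N w ≈ U ^ suc m - V ^ suc m
  binet zero {N} _ =
    R.trans (R.*-congˡ (b-zero N w)) (pointwise λ n → solve 2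
      (λ u v → (u :- v) :* con 1ℚ := u :* con 1ℚ :- v :* con 1ℚ) ≡.refl (seq u n) (seq v n)) ,
    R.trans (R.*-congˡ (B-zero N w)) (pointwise λ n → solve 2
      (λ u v → (u :- v) :* (u :+ v) :* con 1ℚ
         := u :* (u :* con 1ℚ) :* con 1ℚ :- v :* (v :* con 1ℚ) :* con 1ℚ) ≡.refl (seq u n) (seq v n))
  binet (suc m) {suc N} (s≤s m≤N) = odd , even
    where
    p = U ^ m
    q = V ^ m
    bₘ = b m (suc N) w
    odd : (u - v) * b (suc m) (suc N) w ≈ u * (U * p) - v * (V * q)
    -- Two bounds are required: `b-suc` keeps `suc N` for `b` but lowers the bound of `B` to `N`.
    odd with binet m (ℕₚ.m≤n⇒m≤1+n m≤N) | binet m m≤N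
    ... | ih-b , _ | _ , ih-B = begin
      (u - v) * b (suc m) (suc N) w
        ≈⟨ R.*-congˡ (b-suc m N w) ⟩
      (u - v) * (w * B m N w + bₘ)
        ≈⟨ pointwise (λ n → solve 4 (λ u v b B →
             (u :- v) :* ((u :+ v) :* ((u :+ v) :* con 1ℚ) :* B :+ b)
               := (u :+ v) :* ((u :- v) :* (u :+ v) :* B) :+ (u :- v) :* b)
             ≡.refl (seq u n) (seq v n) (seq bₘ n) (seq (B m N w) n)) ⟩
      (u + v) * ((u - v) * (u + v) * B m N w) + (u - v) * bₘ
        ≈⟨ R.+-cong (R.*-congˡ ih-B) ih-b ⟩
      (u + v) * (U * p - V * q) + (u * p - v * q)
        ≈⟨ pointwise (λ n → solve 4 (λ u v p q →
             let U = u :* (u :* con 1ℚ); V = v :* (v :* con 1ℚ) in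
             (u :+ v) :* (U :* p :- V :* q) :+ (u :* p :- v :* q)
               := u :* (U :* p) :- v :* (V :* q) :+ (u :* v :+ con 1ℚ) :* (u :* p :- v :* q))
             ≡.refl (seq u n) (seq v n) (seq p n) (seq q n)) ⟩
      u * (U * p) - v * (V * q) + (u * v + 1ℝ) * (u * p - v * q)
        ≈⟨ drop _ _ ⟩
      u * (U * p) - v * (V * q) ∎
    even : (u - v) * (u + v) * B (suc m) (suc N) w ≈ U * (U * p) - V * (V * q)
    even with binet m (ℕₚ.m≤n⇒m≤1+n m≤N)
    ... | _ , ih-B = begin
      (u - v) * (u + v) * B (suc m) (suc N) w
        ≈⟨ R.*-congˡ (B-suc m (suc N) w) ⟩
      (u - v) * (u + v) * (bₛ + Bₘ)
        ≈⟨ pointwise (λ n → solve 4 (λ u v b B →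
             (u :- v) :* (u :+ v) :* (b :+ B)
               := (u :+ v) :* ((u :- v) :* b) :+ (u :- v) :* (u :+ v) :* B)
             ≡.refl (seq u n) (seq v n) (seq bₛ n) (seq Bₘ n)) ⟩
      (u + v) * ((u - v) * bₛ) + (u - v) * (u + v) * Bₘ
        ≈⟨ R.+-cong (R.*-congˡ odd) ih-B ⟩
      (u + v) * (u * (U * p) - v * (V * q)) + (U * p - V * q)
        ≈⟨ pointwise (λ n → solve 4 (λ u v p q →
             let U = u :* (u :* con 1ℚ); V = v :* (v :* con 1ℚ) in
             (u :+ v) :* (u :* (U :* p) :- v :* (V :* q)) :+ (U :* p :- V :* q)
               := U :* (U :* p) :- V :* (V :* q) :+ (u :* v :+ con 1ℚ) :* (U :* p :- V :* q))
             ≡.refl (seq u n) (seq v n) (seq p n) (seq q n)) ⟩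
      U * (U * p) - V * (V * q) + (u * v + 1ℝ) * (U * p - V * q)
        ≈⟨ drop _ _ ⟩
      U * (U * p) - V * (V * q) ∎
      where
      bₛ = b (suc m) (suc N) w
      Bₘ = B m (suc N) w

  U*V≈1 : u ^ 2 * v ^ 2 ≈ 1ℝ
  U*V≈1 = begin
    U * V
      ≈⟨ pointwise (λ n → solve 2 (λ u v →
           u :* (u :* con 1ℚ) :* (v :* (v :* con 1ℚ))
             := con 1ℚ :+ (u :* v :+ con 1ℚ) :* (u :* v :- con 1ℚ)) ≡.refl (seq u n) (seq v n)) ⟩
    1ℝ + (u * v + 1ℝ) * (u * v - 1ℝ)
      ≈⟨ drop _ _ ⟩
    1ℝ ∎

  -- Multiplying by v² amounts to dividing by u², as u²v² = 1. The quartic is palindromic in x², so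
  -- the quotient is symmetric in u and v.
  quartic*V : ∀ a → (u ^ 4 + 2ℝ * a * u ^ 2 + 1ℝ) * v ^ 2 ≈ u ^ 2 + v ^ 2 + 2ℝ * a
  quartic*V a = begin
    (u ^ 4 + 2ℝ * a * U + 1ℝ) * V
      ≈⟨ pointwise (λ n → solve 3 (λ u v a →
           let U = u :* (u :* con 1ℚ); V = v :* (v :* con 1ℚ); 2a = (con 1ℚ :+ con 1ℚ) :* a in
           (u :* (u :* U) :+ 2a :* U :+ con 1ℚ) :* V := U :* V :* (U :+ 2a) :+ V)
           ≡.refl (seq u n) (seq v n) (seq a n)) ⟩
    U * V * (U + 2ℝ * a) + V
      ≈⟨ R.+-congʳ (R.trans (R.*-congʳ U*V≈1) (R.*-identityˡ _)) ⟩
    U + 2ℝ * a + V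
      ≈⟨ pointwise (λ n → solve 3 (λ x y z → x :+ y :+ z := x :+ z :+ y) ≡.refl
           (seq U n) (seq (2ℝ * a) n) (seq V n)) ⟩
    U + V + 2ℝ * a ∎

  -- The factor is (2c)^(m+1) = (P V)^(m+1), and `Q` at `u` is the inverse of P^(m+1), leaving
  -- V^(m+1).
  Q-value : ∀ m a -1<a {c} → u ^ 2 + v ^ 2 + 2ℝ * a ≈ 2ℝ * c →
    2ℝ * (2ℝ ^ m * c ^ suc m) * Q m a -1<a u ≈ v ^ 2 * (v ^ 2) ^ m
  Q-value m a -1<a {c} h = begin
    2ℝ * (2ℝ ^ m * c ^ suc m) * q
      ≈⟨ R.*-congʳ (R.*-assoc 2ℝ (2ℝ ^ m) (c ^ suc m)) ⟨
    2ℝ ^ suc m * c ^ suc m * q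
      ≈⟨ R.*-congʳ (CE.^-distrib-* 2ℝ c (suc m)) ⟨
    (2ℝ * c) ^ suc m * q
      ≈⟨ R.*-congʳ (E.^-congˡ (suc m) (R.trans (quartic*V a) h)) ⟨
    (P * V) ^ suc m * q
      ≈⟨ R.*-congʳ (CE.^-distrib-* P V (suc m)) ⟩
    P ^ suc m * V ^ suc m * q
      ≈⟨ R.*-assoc _ _ _ ⟩
    P ^ suc m * (V ^ suc m * q)
      ≈⟨ *-/-cancel (V ^ suc m) (P ^ suc m) _ ⟩
    V ^ suc m ∎
    where
    P = u ^ 4 + 2ℝ * a * u ^ 2 + 1ℝ
    q = Q m a -1<a u

-- Identification of T and the final computation.

-- Symmetry of binomials turns the lower index m - k into 2k; this is valid since k ≤ m throughout
-- the sum.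
T≈b : ∀ m {z w} → z ^ 2 ≈ w → T m z ≈ b m m w
T≈b m {z} z²≈w = S.sum-cong-≋ {suc m} λ i → M.×-cong (binomial (toℕ≤pred[n] i))
  (R.trans (R.sym (E.^-assocʳ z 2 (toℕ i))) (E.^-congˡ (toℕ i) z²≈w))
  where
  k*2 : ∀ j k → j ℕ.+ k ℕ.+ k ≡ j ℕ.+ k ℕ.* 2
  k*2 = ℕ-Solver.solve-∀
  binomial : ∀ {k} → k ℕ.≤ m → (m ℕ.+ k) C (m ∸ k) ≡ (k ℕ.+ m) C (k ℕ.* 2)
  binomial {k} k≤m = ≡.trans
    (nCk≡nC[n∸k] (ℕₚ.≤-trans (ℕₚ.m∸n≤m m k) (ℕₚ.m≤m+n m k)))
    (≡.cong₂ _C_ (ℕₚ.+-comm m k) (≡.trans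
      -- Only the first `m` is rewritten, as `(m ∸ k) + k`, so that the truncated subtraction
      -- cancels.
      (≡.cong (λ n → n ℕ.+ k ∸ (m ∸ k)) (≡.sym (ℕₚ.m∸n+n≡m k≤m)))
      (≡.trans (≡.cong (_∸ (m ∸ k)) (k*2 (m ∸ k) k)) (ℕₚ.m+n∸m≡n (m ∸ k) (k ℕ.* 2)))))

mainTheorem4 : (m : ℕ) (a : ℝ) (-1<a : - 1ℝ < a) (y : ℝ) →
    Q₁ m a -1<a y ≈
    T m (2ℝ * y) / 2ℝ ^ m * (1ℝ + a + 2ℝ * y ^ 2) ^ suc m
    [ pos⇒#0 (*-pos (^-pos m 0<2) (^-pos (suc m) (1+a+2y²-pos -1<a y))) ]
-- The factor `2ℝ * s * D` clears both denominators, `s` and `D`. Its 2 raises the 2^m in `D` to the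
-- 2^(m+1) of `Q-value`, and `2ℝ * s` returns as u - v.
mainTheorem4 m a -1<a y = *-cancelˡ-#0 (pos⇒#0 (*-pos (*-pos 0<2 0<s) 0<D)) (begin
  2ℝ * s * D * Q₁ m a -1<a y
    ≈⟨ pointwise (λ n → solve 5 (λ t s D p r →
         con 1ℚ :* (con 1ℚ :+ con 1ℚ) :* s :* D :* (p :+ t :* r)
           := (con 1ℚ :+ con 1ℚ) :* D :* (s :* p :+ s :* t :* r))
         ≡.refl (seq t n) (seq s n) (seq D n) (seq (qu + qv) n) (seq (qu - qv) n)) ⟩
  2ℝ * D * (s * (qu + qv) + s * t * (qu - qv))
    ≈⟨ R.*-congˡ (R.+-congˡ (R.*-congʳ (*-/-cancel y s (pos⇒#0 0<s)))) ⟩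
  2ℝ * D * (s * (qu + qv) + y * (qu - qv))
    ≈⟨ pointwise (λ n → solve 5 (λ y s D qu qv →
         let 2D = (con 1ℚ :+ con 1ℚ) :* D in
         2D :* (s :* (qu :+ qv) :+ y :* (qu :- qv))
           := (y :+ s) :* (2D :* qu) :- (y :- s) :* (2D :* qv))
         ≡.refl (seq y n) (seq s n) (seq D n) (seq qu n) (seq qv n)) ⟩
  u * (2ℝ * D * qu) - v * (2ℝ * D * qv)
    ≈⟨ R.+-cong (R.*-congˡ (Q-value uv≈-1 m a -1<a U+V+2a≈2c))
                (R.-‿cong (R.*-congˡ (Q-value vu≈-1 m a -1<a V+U+2a≈2c))) ⟩
  u * (v ^ 2 * q) - v * (u ^ 2 * p)
    -- Extracting `u * v` from both products leaves odd powers; its value -1 then exchanges the two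
    -- terms.
    ≈⟨ pointwise (λ n → solve 4 (λ u v p q →
         u :* (v :* (v :* con 1ℚ) :* q) :- v :* (u :* (u :* con 1ℚ) :* p)
           := (u :* v) :* (v :* q :- u :* p))
         ≡.refl (seq u n) (seq v n) (seq p n) (seq q n)) ⟩
  u * v * (v * q - u * p)
    ≈⟨ R.*-congʳ uv≈-1 ⟩
  - 1ℝ * (v * q - u * p)
    ≈⟨ pointwise (λ n → solve 2 (λ x z → :- con 1ℚ :* (z :- x) := x :- z)
         ≡.refl (seq (u * p) n) (seq (v * q) n)) ⟩
  u * p - v * q
    ≈⟨ proj₁ (binet uv≈-1 m ℕₚ.≤-refl) ⟨
  (u - v) * b m m ((u + v) ^ 2)
    ≈⟨ R.*-cong u-v≈2s (R.sym (T≈b m [2y]²≈[u+v]²)) ⟩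
  2ℝ * s * T m (2ℝ * y)
    ≈⟨ R.*-congˡ (*-/-cancel (T m (2ℝ * y)) D (pos⇒#0 0<D)) ⟨
  2ℝ * s * (D * (T m (2ℝ * y) / D [ pos⇒#0 0<D ]))
    ≈⟨ R.*-assoc (2ℝ * s) D _ ⟨
  2ℝ * s * D * (T m (2ℝ * y) / D [ pos⇒#0 0<D ]) ∎)
  where
  c s D u v p q : ℝ
  c = 1ℝ + a + 2ℝ * y ^ 2
  s = √ (y ^ 2 + 1ℝ)
  0<s : 0ℝ < s
  0<s = √-pos (y²+1-pos y)
  D = 2ℝ ^ m * c ^ suc m
  0<D : 0ℝ < D
  0<D = *-pos (^-pos m 0<2) (^-pos (suc m) (1+a+2y²-pos -1<a y))
  u = y + s
  v = y - s
  p = (u ^ 2) ^ m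
  q = (v ^ 2) ^ m
  t qu qv : ℝ
  t = y / s [ pos⇒#0 0<s ]
  qu = Q m a -1<a u
  qv = Q m a -1<a v
  s*s≈y²+1 : s * s ≈ y ^ 2 + 1ℝ
  s*s≈y²+1 = √-square (<⇒≤ (y²+1-pos y))
  uv≈-1 : u * v ≈ - 1ℝ
  uv≈-1 = begin
    u * v
      ≈⟨ pointwise (λ n → solve 2 (λ y s → (y :+ s) :* (y :- s) := y :* (y :* con 1ℚ) :- s :* s)
           ≡.refl (seq y n) (seq s n)) ⟩
    y ^ 2 - s * s
      ≈⟨ R.+-congˡ (R.-‿cong s*s≈y²+1) ⟩
    y ^ 2 - (y ^ 2 + 1ℝ)
      ≈⟨ pointwise (λ n → solve 1 (λ x → x :- (x :+ con 1ℚ) := :- con 1ℚ) ≡.refl (seq (y ^ 2) n)) ⟩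
    - 1ℝ ∎
  vu≈-1 : v * u ≈ - 1ℝ
  vu≈-1 = R.trans (R.*-comm v u) uv≈-1
  U+V+2a≈2c : u ^ 2 + v ^ 2 + 2ℝ * a ≈ 2ℝ * c
  U+V+2a≈2c = begin
    u ^ 2 + v ^ 2 + 2ℝ * a
      ≈⟨ pointwise (λ n → solve 3 (λ y s a →
           let u = y :+ s; v = y :- s; 2' = con 1ℚ :+ con 1ℚ in
           u :* (u :* con 1ℚ) :+ v :* (v :* con 1ℚ) :+ 2' :* a
             := 2' :* (a :+ y :* (y :* con 1ℚ) :+ s :* s))
           ≡.refl (seq y n) (seq s n) (seq a n)) ⟩
    2ℝ * (a + y ^ 2 + s * s)
      ≈⟨ R.*-congˡ (R.+-congˡ s*s≈y²+1) ⟩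
    2ℝ * (a + y ^ 2 + (y ^ 2 + 1ℝ))
      ≈⟨ pointwise (λ n → solve 2 (λ x a →
           let 2' = con 1ℚ :+ con 1ℚ in
           2' :* (a :+ x :+ (x :+ con 1ℚ)) := 2' :* (con 1ℚ :+ a :+ 2' :* x))
           ≡.refl (seq (y ^ 2) n) (seq a n)) ⟩
    2ℝ * c ∎
  V+U+2a≈2c : v ^ 2 + u ^ 2 + 2ℝ * a ≈ 2ℝ * c
  V+U+2a≈2c = R.trans (R.+-congʳ (R.+-comm (v ^ 2) (u ^ 2))) U+V+2a≈2c
  u-v≈2s : u - v ≈ 2ℝ * s
  u-v≈2s = pointwise λ n → solve 2 (λ y s → (y :+ s) :- (y :- s) := (con 1ℚ :+ con 1ℚ) :* s)
    ≡.refl (seq y n) (seq s n)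
  [2y]²≈[u+v]² : (2ℝ * y) ^ 2 ≈ (u + v) ^ 2
  [2y]²≈[u+v]² = E.^-congˡ 2 (pointwise λ n → solve 2
    (λ y s → (con 1ℚ :+ con 1ℚ) :* y := (y :+ s) :+ (y :- s)) ≡.refl (seq y n) (seq s n))
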